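{- Let $\{\varphi\}p\{\psi\}$ be a Hoare triple, write $\mathrm{vc}(\{\varphi\}p\{\psi\})$ as $\exists I_1\cdots\exists I_n\,\pi$ with $\pi=\forall^*\,\widetilde{\mathrm{vc}}(\{\varphi\}p\{\psi\})$, and let $\mu_j=[\mathrm{lfp}_{I_j}\,\Phi_\pi]$ for $j=1,\ldots,n$. Then $\mathbb{Z} \models \mathrm{vc}(\{\varphi\}p\{\psi\})$ if and only if $\mathbb{Z} \models \widetilde{\mathrm{vc}}(\{\varphi\}p\{\psi\})[I_1\backslash\mu_1,\ldots,I_n\backslash\mu_n]$.
   Context: Language and programs: $\mathcal{L}=\{0,1,+,-,\cdot,\leq\}$ is the first-order language of arithmetic (with equality) and $\mathbb{Z}$ its standard model on the integers. $\mathbb{Z}\models\theta$ for a formula $\theta$ with free individual variables means that its universal closure holds. Let $x_1,\ldots,x_k$ be the program variables. Programs are given by $$p ::= \textbf{skip} \mid x_j := t \mid p_0;p_1 \mid \textbf{if } B \textbf{ then } p_0 \textbf{ else } p_1 \mid \textbf{while } B \textbf{ do } p_0,$$ with $t$ an $\mathcal{L}$-term and $B$ a quantifier-free $\mathcal{L}$-formula, both over the program variables. A Hoare triple $\{\varphi\}p\{\psi\}$ consists of a program $p$ and first-order $\mathcal{L}$-formulas $\varphi,\psi$ whose free variables are program variables. Verification condition: $\mathrm{vc}(\{\varphi\}p\{\psi\})=\exists\overline{I}\,\forall^*\,\widetilde{\mathrm{vc}}(\{\varphi\}p\{\psi\})$, where $\forall^*$ is universal closure over individual variables, $\overline{I}$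 are all predicate variables occurring, existential quantifiers over predicate variables range over all relations on $\mathbb{Z}$, and $\widetilde{\mathrm{vc}}$ is defined by recursion on $p$: (1) $\widetilde{\mathrm{vc}}(\{\varphi\}\textbf{skip}\{\psi\})=\varphi\to\psi$; (2) $\widetilde{\mathrm{vc}}(\{\varphi\}x_j:=t\{\psi\})=\varphi\to\psi[x_j\backslash t]$; (3) $\widetilde{\mathrm{vc}}(\{\varphi\}p_0;p_1\{\psi\})=\widetilde{\mathrm{vc}}(\{\varphi\}p_0\{I\})\land\widetilde{\mathrm{vc}}(\{I\}p_1\{\psi\})$; (4) $\widetilde{\mathrm{vc}}(\{\varphi\}\textbf{if }B\textbf{ then }p_0\textbf{ else }p_1\{\psi\})=\widetilde{\mathrm{vc}}(\{\varphi\land B\}p_0\{\psi\})\land\widetilde{\mathrm{vc}}(\{\varphi\land\neg B\}p_1\{\psi\})$; (5) $\widetilde{\mathrm{vc}}(\{\varphi\}\textbf{while }B\textbf{ do }p_0\{\psi\})=\widetilde{\mathrm{vc}}(\{I\land B\}p_0\{I\})\land(\varphi\to I)\land(I\land\neg B\to\psi)$. In (3) and (5), $I$ is a fresh $k$-ary predicate variable (distinct from all others used), and $I$ abbreviates the atom $I(x_1,\ldots,x_k)$, so $I[x_j\backslash t]$ is $I(x_1,\ldots,t,\ldots,x_k)$. The recursion applies also when $\varphi,\psi$ contain predicate variables. Horn form: every conjunct of $\widetilde{\mathrm{vc}}$ is an implication whose premise is a conjunction of first-order formulas and at most one predicate-variable atom and whose conclusion is a predicate-variable atom or a first-order formula;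 a conjunct $A\to\theta$ with $\theta$ first-order is read as the clause $A\land\neg\theta\to\bot$. So $\pi$ is a conjunction of constrained Horn clauses, i.e. formulas $\varphi' \land I_{i_1}(\overline{t_1}) \land \cdots \land I_{i_m}(\overline{t_m}) \to I_{i_0}(\overline{s})$ or $\varphi' \land I_{i_1}(\overline{t_1}) \land \cdots \land I_{i_m}(\overline{t_m}) \to \bot$ ($m\ge0$) with $\varphi'$ first-order without predicate variables. Least fixed points: for a tuple $\Phi=(\varphi_i(X_1,\ldots,X_n,\overline{u_i}))_{i=1}^n$ of formulas in which the $X_j$ occur only positively, with $|\overline{u_i}|=k_i$ the arity of $X_i$, and a structure $\mathcal{M}$ with domain $M$, let $F_\Phi=(F_1,\ldots,F_n)$ on $\mathcal{P}(M^{k_1})\times\cdots\times\mathcal{P}(M^{k_n})$, $F_i(R_1,\ldots,R_n)=\{\overline{a}\in M^{k_i}\mid \mathcal{M}\models\varphi_i(R_1,\ldots,R_n,\overline{a})\}$. This is monotone; $[\mathrm{lfp}_{X_i}\,\Phi]$ is interpreted in $\mathcal{M}$ as the $i$-th component of the least fixed point of $F_\Phi$. The tuple $\Phi_\pi$: let $B_j$ be the set of clauses of $\pi$ of the form $\varphi'\to I_j(\overline{s})$, written $(\varphi',\overline{s})$, and $\mathrm{Ind}_j$ the set of clauses $\varphi'\land I_{i_1}(\overline{t_1})\land\cdots\land I_{i_m}(\overline{t_m})\to I_j(\overline{s})$ with $m\ge1$, written $(\varphi',\iota,\tau,\overline{s})$, $\iota=(i_1,\ldots,i_m)$, $\tau=(\overline{t_1},\ldots,\overline{t_m})$.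 Then $\Phi_\pi=(\varphi_j(I_1,\ldots,I_n,\overline{z_j}))_{j=1}^n$, where $\varphi_j$ is $$\exists \overline{y}\left(\bigvee_{(\varphi',\overline{s})\in B_j}(\varphi'\land\overline{z_j}=\overline{s})\lor\bigvee_{(\varphi',\iota,\tau,\overline{s})\in \mathrm{Ind}_j}\Big(\varphi'\land\bigwedge_{l=1}^m I_{i_l}(\overline{t_l})\land\overline{z_j}=\overline{s}\Big)\right),$$ $\overline{y}$ being the free variables of the clauses in $B_j\cup \mathrm{Ind}_j$ and $\overline{z_j}$ fresh variables, as many as the arity of $I_j$ (empty disjunctions are false). $[I_1\backslash\mu_1,\ldots,I_n\backslash\mu_n]$ is simultaneous substitution of predicates. -}

module Defs where

open import Data.Empty using (⊥; ⊥-elim)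
open import Data.Fin using (Fin; zero; suc; _↑ˡ_; _↑ʳ_; _≟_)
import Data.Integer as ℤ
open import Data.Integer using (ℤ; 0ℤ; 1ℤ)
open import Data.List as List using (List; []; _∷_; _++_; foldr; mapMaybe; fromMaybe)
open import Data.Maybe as Maybe using (Maybe; just; nothing; when; zipWith)
open import Data.Nat using (ℕ; zero; suc; _+_)
open import Data.Product using (Σ; Σ-syntax; _×_; _,_; proj₁)
open import Data.Sum as Sum using (_⊎_; inj₁; inj₂)
open import Data.Unit using (⊤; tt)
open import Data.Vec as Vec using (Vec; []; _∷_; lookup)
open import Data.Vec.Functional using (updateAt)
open import Function using (_∘_; const; id)
open import Relation.Binary.PropositionalEquality using (_≡_)
open import Relation.Nullary using (does)

-- Terms over n individual variables (de Bruijn indices); minus is binary.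
data Term (n : ℕ) : Set where
  var         : Fin n → Term n
  𝟎 𝟏         : Term n
  _⊕_ _⊖_ _⊗_ : Term n → Term n → Term n

-- S m is the type of m-ary predicate symbols.
Sig : Set₁
Sig = ℕ → Set

infix  7 _≐_ _≦_
infixr 6 _∧_
infixr 5 _∨_
infixr 4 _⇒_

-- Formulas in which the symbols of N may occur anywhere and those of P
-- never to the left of an implication.  Hence
--   Formula N N  is the class of all formulas over N,
--   Formula ∅ P  is a class of formulas positive in P; allowing only strictly
--                positive occurrences makes least fixed points inductive
--                types, and classically every positive formula is equivalent
--                to one of these (by negation normal form).
data Formula (N P : Sig) (n : ℕ) : Set where
  falsum verum : Formula N P n
  _≐_ _≦_      : Term n → Term n → Formula N P n
  pred         : ∀ {m} → P m → Vec (Term n) m → Formula N P n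
  _∧_ _∨_      : Formula N P n → Formula N P n → Formula N P n
  _⇒_          : Formula N N n → Formula N P n → Formula N P n
  all ex       : Formula N P (suc n) → Formula N P n

∅ : Sig
∅ _ = ⊥

Fm : Sig → ℕ → Set
Fm S = Formula S S

FO : ℕ → Set
FO = Fm ∅

neg : ∀ {S n} → Fm S n → Fm S n
neg φ = φ ⇒ falsum

⋁ ⋀ : ∀ {N P n} → List (Formula N P n) → Formula N P n
⋁ = foldr _∨_ falsum
⋀ = foldr _∧_ verum

ex* : ∀ {N P n} v → Formula N P (v + n) → Formula N P n
ex* zero    φ = φ
ex* (suc v) φ = ex* v (ex φ)

vars : ∀ {n} → Vec (Term n) n
vars = Vec.tabulate var

QuantifierFree : ∀ {n} → FO n → Set
QuantifierFree falsum   = ⊤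
QuantifierFree verum    = ⊤
QuantifierFree (s ≐ t)  = ⊤
QuantifierFree (s ≦ t)  = ⊤
QuantifierFree (φ ∧ ψ)  = QuantifierFree φ × QuantifierFree ψ
QuantifierFree (φ ∨ ψ)  = QuantifierFree φ × QuantifierFree ψ
QuantifierFree (φ ⇒ ψ)  = QuantifierFree φ × QuantifierFree ψ
QuantifierFree (all φ)  = ⊥
QuantifierFree (ex φ)   = ⊥

subₜ : ∀ {m n} → (Fin m → Term n) → Term m → Term n
subₜ σ (var i) = σ i
subₜ σ 𝟎       = 𝟎
subₜ σ 𝟏       = 𝟏
subₜ σ (s ⊕ t) = subₜ σ s ⊕ subₜ σ t
subₜ σ (s ⊖ t) = subₜ σ s ⊖ subₜ σ t
subₜ σ (s ⊗ t) = subₜ σ s ⊗ subₜ σ t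

lift : ∀ {m n} → (Fin m → Term n) → Fin (suc m) → Term (suc n)
lift σ zero    = var zero
lift σ (suc i) = subₜ (var ∘ suc) (σ i)

sub : ∀ {N P m n} → (Fin m → Term n) → Formula N P m → Formula N P n
sub σ falsum      = falsum
sub σ verum       = verum
sub σ (s ≐ t)     = subₜ σ s ≐ subₜ σ t
sub σ (s ≦ t)     = subₜ σ s ≦ subₜ σ t
sub σ (pred X ts) = pred X (Vec.map (subₜ σ) ts)
sub σ (φ ∧ ψ)     = sub σ φ ∧ sub σ ψ
sub σ (φ ∨ ψ)     = sub σ φ ∨ sub σ ψ
sub σ (φ ⇒ ψ)     = sub σ φ ⇒ sub σ ψ
sub σ (all φ)     = all (sub (lift σ) φ)
sub σ (ex φ)      = ex (sub (lift σ) φ)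

_[_≔_] : ∀ {S n} → Fm S n → Fin n → Term n → Fm S n
ψ [ j ≔ t ] = sub (updateAt var j (const t)) ψ

mapₚ : ∀ {N N′ P P′ n} → (∀ {m} → N m → N′ m) → (∀ {m} → P m → P′ m) →
       Formula N P n → Formula N′ P′ n
mapₚ f g falsum      = falsum
mapₚ f g verum       = verum
mapₚ f g (s ≐ t)     = s ≐ t
mapₚ f g (s ≦ t)     = s ≦ t
mapₚ f g (pred X ts) = pred (g X) ts
mapₚ f g (φ ∧ ψ)     = mapₚ f g φ ∧ mapₚ f g ψ
mapₚ f g (φ ∨ ψ)     = mapₚ f g φ ∨ mapₚ f g ψ
mapₚ f g (φ ⇒ ψ)     = mapₚ f f φ ⇒ mapₚ f g ψ
mapₚ f g (all φ)     = all (mapₚ f g φ)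
mapₚ f g (ex φ)      = ex (mapₚ f g φ)

_[_]ₚ : ∀ {S S′ n} → Fm S n → (∀ {m} → S m → S′ m) → Fm S′ n
φ [ μ ]ₚ = mapₚ μ μ φ

⌜_⌝ : ∀ {N P n} → FO n → Formula N P n
⌜ θ ⌝ = mapₚ ⊥-elim ⊥-elim θ

⟦_⟧ : ∀ {n} → Term n → Vec ℤ n → ℤ
⟦ var i ⟧ ρ = lookup ρ i
⟦ 𝟎 ⟧     ρ = 0ℤ
⟦ 𝟏 ⟧     ρ = 1ℤ
⟦ s ⊕ t ⟧ ρ = ⟦ s ⟧ ρ ℤ.+ ⟦ t ⟧ ρ
⟦ s ⊖ t ⟧ ρ = ⟦ s ⟧ ρ ℤ.- ⟦ t ⟧ ρ
⟦ s ⊗ t ⟧ ρ = ⟦ s ⟧ ρ ℤ.* ⟦ t ⟧ ρ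

Interp : Sig → Set₁
Interp S = ∀ {m} → S m → Vec ℤ m → Set

Sat : ∀ {S n} → Interp S → Fm S n → Vec ℤ n → Set
Sat 𝓘 falsum      ρ = ⊥
Sat 𝓘 verum       ρ = ⊤
Sat 𝓘 (s ≐ t)     ρ = ⟦ s ⟧ ρ ≡ ⟦ t ⟧ ρ
Sat 𝓘 (s ≦ t)     ρ = ⟦ s ⟧ ρ ℤ.≤ ⟦ t ⟧ ρ
Sat 𝓘 (pred X ts) ρ = 𝓘 X (Vec.map (λ t → ⟦ t ⟧ ρ) ts)
Sat 𝓘 (φ ∧ ψ)     ρ = Sat 𝓘 φ ρ × Sat 𝓘 ψ ρ
Sat 𝓘 (φ ∨ ψ)     ρ = Sat 𝓘 φ ρ ⊎ Sat 𝓘 ψ ρ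
Sat 𝓘 (φ ⇒ ψ)     ρ = Sat 𝓘 φ ρ → Sat 𝓘 ψ ρ
Sat 𝓘 (all φ)     ρ = ∀ a → Sat 𝓘 φ (a ∷ ρ)
Sat 𝓘 (ex φ)      ρ = Σ[ a ∈ ℤ ] Sat 𝓘 φ (a ∷ ρ)

∅ᴵ : Interp ∅
∅ᴵ ()

infix 3 _⊨_
_⊨_ : ∀ {S n} → Interp S → Fm S n → Set
𝓘 ⊨ φ = ∀ ρ → Sat 𝓘 φ ρ

-- The prefix ∃ ranges over all symbols of S.
ℤ⊨∃∀*_ : ∀ {S n} → Fm S n → Set₁
ℤ⊨∃∀*_ {S} φ = Σ[ R ∈ Interp S ] ((λ {m} → R {m}) ⊨ φ)

System : Sig → Set
System S = ∀ {m} → S m → Formula ∅ S m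

-- The same semantics for the positive formulas; a separate function, so that
-- the positivity checker sees that 𝓘 is used strictly positively.
Sat⁺ : ∀ {S n} → Interp S → Formula ∅ S n → Vec ℤ n → Set
Sat⁺ 𝓘 falsum      ρ = ⊥
Sat⁺ 𝓘 verum       ρ = ⊤
Sat⁺ 𝓘 (s ≐ t)     ρ = ⟦ s ⟧ ρ ≡ ⟦ t ⟧ ρ
Sat⁺ 𝓘 (s ≦ t)     ρ = ⟦ s ⟧ ρ ℤ.≤ ⟦ t ⟧ ρ
Sat⁺ 𝓘 (pred X ts) ρ = 𝓘 X (Vec.map (λ t → ⟦ t ⟧ ρ) ts)
Sat⁺ 𝓘 (φ ∧ ψ)     ρ = Sat⁺ 𝓘 φ ρ × Sat⁺ 𝓘 ψ ρ
Sat⁺ 𝓘 (φ ∨ ψ)     ρ = Sat⁺ 𝓘 φ ρ ⊎ Sat⁺ 𝓘 ψ ρ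
Sat⁺ 𝓘 (φ ⇒ ψ)     ρ = Sat ∅ᴵ φ ρ → Sat⁺ 𝓘 ψ ρ
Sat⁺ 𝓘 (all φ)     ρ = ∀ a → Sat⁺ 𝓘 φ (a ∷ ρ)
Sat⁺ 𝓘 (ex φ)      ρ = Σ[ a ∈ ℤ ] Sat⁺ 𝓘 φ (a ∷ ρ)

⟪_⟫ : ∀ {S} → System S → Interp S → Interp S
⟪ Φ ⟫ R X = Sat⁺ R (Φ X)

infix 4 _⊆_
_⊆_ : ∀ {S} → Interp S → Interp S → Set
_⊆_ {S} R R′ = ∀ {m} (X : S m) {a} → R X a → R′ X a

data Lfp {S : Sig} (Φ : System S) : ∀ {m} → S m → Vec ℤ m → Set where
  fold : ∀ {m} {X : S m} {a} → ⟪ Φ ⟫ (Lfp Φ) X a → Lfp Φ X a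

record IsLeastFixedPoint {S : Sig} (F : Interp S → Interp S) (R : Interp S) : Set₁ where
  field
    fixed₁ : F R ⊆ R
    fixed₂ : R ⊆ F R
    least  : (R′ : Interp S) → F R′ ⊆ R′ → R ⊆ R′

module _ {S : Sig} (Φ : System S) (R : Interp S) (closed : ⟪ Φ ⟫ R ⊆ R) where

  Lfp-least : Lfp Φ ⊆ R
  Sat-least : ∀ {n} (φ : Formula ∅ S n) {ρ} → Sat⁺ (Lfp Φ) φ ρ → Sat⁺ R φ ρ

  Lfp-least X (fold s) = closed X (Sat-least (Φ X) s)

  Sat-least verum       s        = s
  Sat-least (_ ≐ _)     s        = s
  Sat-least (_ ≦ _)     s        = s
  Sat-least (pred X _)  s        = Lfp-least X s
  Sat-least (φ ∧ ψ)     (s , t)  = Sat-least φ s , Sat-least ψ t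
  Sat-least (φ ∨ ψ)     (inj₁ s) = inj₁ (Sat-least φ s)
  Sat-least (φ ∨ ψ)     (inj₂ s) = inj₂ (Sat-least ψ s)
  Sat-least (φ ⇒ ψ)     s        = λ x → Sat-least ψ (s x)
  Sat-least (all φ)     s        = λ a → Sat-least φ (s a)
  Sat-least (ex φ)      (a , s)  = a , Sat-least φ s

Lfp-isLeastFixedPoint : ∀ {S} (Φ : System S) → IsLeastFixedPoint ⟪ Φ ⟫ (Lfp Φ)
Lfp-isLeastFixedPoint Φ = record
  { fixed₁ = λ _ → fold
  ; fixed₂ = λ { _ (fold s) → s }
  ; least  = Lfp-least Φ
  }

-- lfp Φ X is the predicate [lfp_X Φ] as a piece of syntax, so that substituting
-- it for a predicate variable is again a formula; its meaning in ℤ is Lfp Φ X.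
data LFP (S : Sig) (m : ℕ) : Set where
  lfp : System S → S m → LFP S m

LFPᴵ : ∀ {S} → Interp (LFP S)
LFPᴵ (lfp Φ X) = Lfp Φ X

infixr 4 _⨾_

data Program (k : ℕ) : Set where
  skip          : Program k
  _:=_          : Fin k → Term k → Program k
  _⨾_           : Program k → Program k → Program k
  if_then_else_ : Σ (FO k) QuantifierFree → Program k → Program k → Program k
  while_loop_     : Σ (FO k) QuantifierFree → Program k → Program k

-- One predicate variable for each sequential composition and each loop.
#_ : ∀ {k} → Program k → ℕ
# skip                     = 0
# (x := t)                 = 0
# (p₀ ⨾ p₁)                = suc (# p₀ + # p₁)
# (if _ then p₀ else p₁)   = # p₀ + # p₁
# (while _ loop p₀)          = suc (# p₀)

data PVar (n k : ℕ) : Sig where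
  I : Fin n → PVar n k k

-- ν enumerates the predicate variables reserved for p; freshness holds because
-- subprograms receive disjoint parts of the enumeration.
ṽc : ∀ {k n} (φ : Fm (PVar n k) k) (p : Program k) (ψ : Fm (PVar n k) k) →
     (Fin (# p) → Fin n) → Fm (PVar n k) k
ṽc φ skip ψ ν = φ ⇒ ψ
ṽc φ (j := t) ψ ν = φ ⇒ ψ [ j ≔ t ]
ṽc φ (p₀ ⨾ p₁) ψ ν =
  ṽc φ p₀ Ix̄ (ν ∘ suc ∘ (_↑ˡ # p₁)) ∧ ṽc Ix̄ p₁ ψ (ν ∘ suc ∘ (# p₀ ↑ʳ_))
  where Ix̄ = pred (I (ν zero)) vars
ṽc φ (if (B , _) then p₀ else p₁) ψ ν =
  ṽc (φ ∧ ⌜ B ⌝) p₀ ψ (ν ∘ (_↑ˡ # p₁)) ∧ ṽc (φ ∧ neg ⌜ B ⌝) p₁ ψ (ν ∘ (# p₀ ↑ʳ_))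
ṽc φ (while (B , _) loop p₀) ψ ν =
  ṽc (Ix̄ ∧ ⌜ B ⌝) p₀ Ix̄ (ν ∘ suc) ∧ (φ ⇒ Ix̄) ∧ (Ix̄ ∧ neg ⌜ B ⌝ ⇒ ψ)
  where Ix̄ = pred (I (ν zero)) vars

record Triple (k : ℕ) : Set where
  constructor ⟨_⟩_⟨_⟩
  field
    pre  : FO k
    prog : Program k
    post : FO k

#ᵀ_ : ∀ {k} → Triple k → ℕ
#ᵀ τ = # Triple.prog τ

ṽcᵀ : ∀ {k} (τ : Triple k) → Fm (PVar (#ᵀ τ) k) k
ṽcᵀ (⟨ φ ⟩ p ⟨ ψ ⟩) = ṽc ⌜ φ ⌝ p ⌜ ψ ⌝ id

ℤ⊨vc_ : ∀ {k} → Triple k → Set₁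
ℤ⊨vc τ = ℤ⊨∃∀* ṽcᵀ τ

module _ (n k : ℕ) where

  Atom : ℕ → Set
  Atom v = Fin n × Vec (Term v) k

  -- The clause  constraint ∧ body₁ ∧ ⋯ ∧ bodyₘ → head  in v variables, where
  -- nothing stands for the head ⊥.
  record Clause (v : ℕ) : Set where
    constructor clause
    field
      constraint : FO v
      body       : List (Atom v)
      head       : Maybe (Atom v)

firstOrder? : ∀ {N P v} → Formula N P v → Maybe (FO v)
firstOrder? falsum      = just falsum
firstOrder? verum       = just verum
firstOrder? (s ≐ t)     = just (s ≐ t)
firstOrder? (s ≦ t)     = just (s ≦ t)
firstOrder? (pred _ _)  = nothing
firstOrder? (φ ∧ ψ)     = zipWith _∧_ (firstOrder? φ) (firstOrder? ψ)
firstOrder? (φ ∨ ψ)     = zipWith _∨_ (firstOrder? φ) (firstOrder? ψ)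
firstOrder? (φ ⇒ ψ)     = zipWith _⇒_ (firstOrder? φ) (firstOrder? ψ)
firstOrder? (all φ)     = Maybe.map all (firstOrder? φ)
firstOrder? (ex φ)      = Maybe.map ex (firstOrder? φ)

premise? : ∀ {n k v} → Fm (PVar n k) v → Maybe (FO v × List (Atom n k v))
premise? (pred (I i) ts) = just (verum , (i , ts) ∷ [])
premise? (φ ∧ ψ)         = zipWith (λ (θ , as) (θ′ , as′) → θ ∧ θ′ , as ++ as′)
                                   (premise? φ) (premise? ψ)
premise? φ               = Maybe.map (_, []) (firstOrder? φ)

conclusion? : ∀ {n k v} → Fm (PVar n k) v → Maybe (Atom n k v ⊎ FO v)
conclusion? (pred (I i) ts) = just (inj₁ (i , ts))
conclusion? φ               = Maybe.map inj₂ (firstOrder? φ)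

mkClause : ∀ {n k v} → FO v × List (Atom n k v) → Atom n k v ⊎ FO v → Clause n k v
mkClause (φ′ , as) (inj₁ a) = clause φ′ as (just a)
mkClause (φ′ , as) (inj₂ θ) = clause (φ′ ∧ neg θ) as nothing

-- Only conjunctions of Horn implications matter here: ṽc produces nothing
-- else, and any other conjunct is dropped.
clauses : ∀ {n k v} → Fm (PVar n k) v → List (Clause n k v)
clauses (π ∧ π′) = clauses π ++ clauses π′
clauses (φ ⇒ ψ)  = fromMaybe (zipWith mkClause (premise? φ) (conclusion? ψ))
clauses _        = []

module _ {n k v : ℕ} where

  BaseClause IndClause : Set
  BaseClause = FO v × Vec (Term v) k
  IndClause  = FO v × List (Atom n k v) × Vec (Term v) k

  asBase : Fin n → Clause n k v → Maybe BaseClause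
  asBase j (clause φ′ [] (just (i , s̄))) = when (does (i ≟ j)) (φ′ , s̄)
  asBase j _                             = nothing

  asInd : Fin n → Clause n k v → Maybe IndClause
  asInd j (clause φ′ as@(_ ∷ _) (just (i , s̄))) = when (does (i ≟ j)) (φ′ , as , s̄)
  asInd j _                                     = nothing

  -- Under the binder ∃ȳ the first v variables are ȳ and the last k are z̄.
  ↑ȳ : Term v → Term (v + k)
  ↑ȳ = subₜ (var ∘ (_↑ˡ k))

  constraintᶠ : ∀ {N P} → FO v → Formula N P (v + k)
  constraintᶠ φ′ = ⌜ sub (var ∘ (_↑ˡ k)) φ′ ⌝

  z̄≐ : ∀ {N P} → Vec (Term v) k → Formula N P (v + k)
  z̄≐ s̄ = ⋀ (List.tabulate λ i → var (v ↑ʳ i) ≐ ↑ȳ (lookup s̄ i))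

  atomᶠ : Atom n k v → Formula ∅ (PVar n k) (v + k)
  atomᶠ (i , t̄) = pred (I i) (Vec.map ↑ȳ t̄)

  baseᶠ : BaseClause → Formula ∅ (PVar n k) (v + k)
  baseᶠ (φ′ , s̄) = constraintᶠ φ′ ∧ z̄≐ s̄

  indᶠ : IndClause → Formula ∅ (PVar n k) (v + k)
  indᶠ (φ′ , as , s̄) = constraintᶠ φ′ ∧ ⋀ (List.map atomᶠ as) ∧ z̄≐ s̄

-- ȳ is taken to be all v variables; those not free in the clauses are bound
-- vacuously.
Φ : ∀ {n k v} → Fm (PVar n k) v → System (PVar n k)
Φ {v = v} π (I j) = ex* v
  (  ⋁ (List.map baseᶠ (mapMaybe (asBase j) (clauses π)))
   ∨ ⋁ (List.map indᶠ  (mapMaybe (asInd j)  (clauses π))))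

μ : ∀ {k} (τ : Triple k) {m} → PVar (#ᵀ τ) k m → LFP (PVar (#ᵀ τ) k) m
μ τ = lfp (Φ (ṽcᵀ τ))

{-# OPTIONS --safe #-}
module Submission where

-- Every conjunct of ṽc is a Horn implication.  An interpretation R satisfies
-- the definite clauses of π iff it is closed under ⟪ Φ π ⟫.  So a model R of ṽc
-- contains the least fixed point L, and L satisfies the definite clauses; an
-- implication with first-order conclusion passes from R to L because its
-- premise is monotone and its conclusion mentions no predicate variable.

open import Data.Empty using (⊥; ⊥-elim)
open import Data.Fin using (Fin; zero; suc; _↑ˡ_; _↑ʳ_; _≟_)
import Data.Integer as ℤ
open import Data.Integer using (ℤ)
open import Data.List as List using (List; []; _∷_; mapMaybe)
open import Data.List.Relation.Unary.All as All using (All; []; _∷_)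
import Data.List.Relation.Unary.All.Properties as Allₚ
open import Data.List.Relation.Unary.Any as Any using (Any)
import Data.List.Relation.Unary.Any.Properties as Anyₚ
open import Data.List.Membership.Propositional using (_∈_; lose)
open import Data.Maybe as Maybe using (Maybe; just; nothing; zipWith; Is-just)
open import Data.Maybe.Relation.Unary.All as MAll using (just; nothing)
import Data.Maybe.Relation.Unary.All.Properties as MAllₚ
open import Data.Maybe.Relation.Unary.Any as MAny using (just)
open import Data.Nat using (ℕ; zero; suc; _+_)
open import Data.Product using (Σ-syntax; ∃; _×_; _,_; proj₁)
open import Data.Product.Function.NonDependent.Propositional using (_×-⇔_)
open import Data.Sum using (_⊎_; inj₁; inj₂)
open import Data.Sum.Function.Propositional using (_⊎-⇔_)
open import Data.Unit using (tt)
open import Data.Vec as Vec using (Vec; []; _∷_; lookup)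
import Data.Vec.Properties as Vecₚ
open import Function using (_∘_; id)
open import Function.Bundles using (_⇔_; mk⇔; module Equivalence)
open import Function.Construct.Composition using (_⇔-∘_)
open import Function.Construct.Identity using (⇔-id)
open import Function.Related.TypeIsomorphisms using (→-cong-⇔)
open import Relation.Binary.PropositionalEquality
  using (_≡_; refl; sym; trans; cong; cong₂; subst)
open import Relation.Nullary using (yes; no)
open import Defs

open Equivalence using (to; from)

-- Logical equivalences and partial values

≡⇒⇔ : {A B : Set} → A ≡ B → A ⇔ B
≡⇒⇔ refl = ⇔-id _

∀-⇔ : {A : Set} {B C : A → Set} → (∀ a → B a ⇔ C a) → (∀ a → B a) ⇔ (∀ a → C a)
∀-⇔ e = mk⇔ (λ f a → to (e a) (f a)) (λ f a → from (e a) (f a))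

∃-⇔ : {A : Set} {B C : A → Set} → (∀ a → B a ⇔ C a) → ∃ B ⇔ ∃ C
∃-⇔ e = mk⇔ (λ (a , b) → a , to (e a) b) (λ (a , c) → a , from (e a) c)

module _ {A B C : Set} {f : A → B → C} where

  -- On `Maybe`, `All` reads "if defined, then". Soundness of a parser is stated with it, and
  -- success of the parse separately with `Is-just`.
  zipWith-All⁺ : ∀ {p q r} {P : A → Set p} {Q : B → Set q} {R : C → Set r} →
                 (∀ {a b} → P a → Q b → R (f a b)) →
                 ∀ {x y} → MAll.All P x → MAll.All Q y → MAll.All R (zipWith f x y)
  zipWith-All⁺ g (just p) (just q) = just (g p q)
  zipWith-All⁺ g (just p) nothing  = nothing
  zipWith-All⁺ g nothing  _        = nothing

  zipWith-just⁺ : ∀ {x y} → Is-just x → Is-just y → Is-just (zipWith f x y)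
  zipWith-just⁺ (just tt) (just tt) = just tt

  zipWith-just⁻ : ∀ {x y} → Is-just (zipWith f x y) → Is-just x × Is-just y
  zipWith-just⁻ {just _} {just _} _ = just tt , just tt

module _ {A B : Set} {f : A → B} where

  map-just⁺ : ∀ {x} → Is-just x → Is-just (Maybe.map f x)
  map-just⁺ (just tt) = just tt

  map-just⁻ : ∀ {x} → Is-just (Maybe.map f x) → Is-just x
  map-just⁻ {just _} _ = just tt

-- Substitution

-- The valuations are related pointwise, not computed from `σ`. The relation extends under binders
-- by `⟦lift⟧`, and it later covers the passage from `ȳ ++ a` to `ȳ`.
⟦subₜ⟧ : ∀ {m n} {σ : Fin m → Term n} {ρ ρ′} →
         (∀ i → ⟦ σ i ⟧ ρ ≡ lookup ρ′ i) → ∀ t → ⟦ subₜ σ t ⟧ ρ ≡ ⟦ t ⟧ ρ′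
⟦subₜ⟧ e (var i) = e i
⟦subₜ⟧ e 𝟎       = refl
⟦subₜ⟧ e 𝟏       = refl
⟦subₜ⟧ e (s ⊕ t) = cong₂ ℤ._+_ (⟦subₜ⟧ e s) (⟦subₜ⟧ e t)
⟦subₜ⟧ e (s ⊖ t) = cong₂ ℤ._-_ (⟦subₜ⟧ e s) (⟦subₜ⟧ e t)
⟦subₜ⟧ e (s ⊗ t) = cong₂ ℤ._*_ (⟦subₜ⟧ e s) (⟦subₜ⟧ e t)

map-⟦subₜ⟧ : ∀ {l m n} {σ : Fin m → Term n} {ρ ρ′} →
             (∀ i → ⟦ σ i ⟧ ρ ≡ lookup ρ′ i) → (ts : Vec (Term m) l) →
             Vec.map (λ t → ⟦ t ⟧ ρ) (Vec.map (subₜ σ) ts) ≡ Vec.map (λ t → ⟦ t ⟧ ρ′) ts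
map-⟦subₜ⟧ {σ = σ} e ts =
  trans (sym (Vecₚ.map-∘ _ (subₜ σ) ts)) (Vecₚ.map-cong (⟦subₜ⟧ e) ts)

⟦lift⟧ : ∀ {m n} {σ : Fin m → Term n} {ρ ρ′} →
         (∀ i → ⟦ σ i ⟧ ρ ≡ lookup ρ′ i) →
         ∀ a i → ⟦ lift σ i ⟧ (a ∷ ρ) ≡ lookup (a ∷ ρ′) i
⟦lift⟧         e a zero    = refl
⟦lift⟧ {σ = σ} e a (suc i) = trans (⟦subₜ⟧ (λ _ → refl) (σ i)) (e i)

Sat-sub : ∀ {S} (R : Interp S) {m n} {σ : Fin m → Term n} {ρ ρ′} →
          (∀ i → ⟦ σ i ⟧ ρ ≡ lookup ρ′ i) →
          ∀ φ → Sat R (sub σ φ) ρ ⇔ Sat R φ ρ′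
Sat-sub R e falsum      = ⇔-id _
Sat-sub R e verum       = ⇔-id _
Sat-sub R e (s ≐ t)     = ≡⇒⇔ (cong₂ _≡_ (⟦subₜ⟧ e s) (⟦subₜ⟧ e t))
Sat-sub R e (s ≦ t)     = ≡⇒⇔ (cong₂ ℤ._≤_ (⟦subₜ⟧ e s) (⟦subₜ⟧ e t))
Sat-sub R e (pred X ts) = ≡⇒⇔ (cong (R X) (map-⟦subₜ⟧ e ts))
Sat-sub R e (φ ∧ ψ)     = Sat-sub R e φ ×-⇔ Sat-sub R e ψ
Sat-sub R e (φ ∨ ψ)     = Sat-sub R e φ ⊎-⇔ Sat-sub R e ψ
Sat-sub R e (φ ⇒ ψ)     = →-cong-⇔ (Sat-sub R e φ) (Sat-sub R e ψ)
Sat-sub R e (all φ)     = ∀-⇔ λ a → Sat-sub R (⟦lift⟧ e a) φ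
Sat-sub R e (ex φ)      = ∃-⇔ λ a → Sat-sub R (⟦lift⟧ e a) φ

module _ {S S′ : Sig} (f : ∀ {m} → S m → S′ m) (R : Interp S) (R′ : Interp S′)
         (e : ∀ {m} (X : S m) a → R′ (f X) a ⇔ R X a) where

  -- Serves twice: for first-order formulas embedded to the left of an implication, and for the
  -- substitution of `μ τ`.
  Sat-mapₚ : ∀ {n} (φ : Fm S n) {ρ} → Sat R′ (mapₚ f f φ) ρ ⇔ Sat R φ ρ
  Sat-mapₚ falsum      = ⇔-id _
  Sat-mapₚ verum       = ⇔-id _
  Sat-mapₚ (s ≐ t)     = ⇔-id _
  Sat-mapₚ (s ≦ t)     = ⇔-id _
  Sat-mapₚ (pred X ts) = e X _
  Sat-mapₚ (φ ∧ ψ)     = Sat-mapₚ φ ×-⇔ Sat-mapₚ ψ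
  Sat-mapₚ (φ ∨ ψ)     = Sat-mapₚ φ ⊎-⇔ Sat-mapₚ ψ
  Sat-mapₚ (φ ⇒ ψ)     = →-cong-⇔ (Sat-mapₚ φ) (Sat-mapₚ ψ)
  Sat-mapₚ (all φ)     = ∀-⇔ λ a → Sat-mapₚ φ
  Sat-mapₚ (ex φ)      = ∃-⇔ λ a → Sat-mapₚ φ

Sat⁺-⌜⌝ : ∀ {S} (R : Interp S) {n} (θ : FO n) {ρ} → Sat⁺ R ⌜ θ ⌝ ρ ⇔ Sat ∅ᴵ θ ρ
Sat⁺-⌜⌝ R falsum  = ⇔-id _
Sat⁺-⌜⌝ R verum   = ⇔-id _
Sat⁺-⌜⌝ R (s ≐ t) = ⇔-id _
Sat⁺-⌜⌝ R (s ≦ t) = ⇔-id _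
Sat⁺-⌜⌝ R (φ ∧ ψ) = Sat⁺-⌜⌝ R φ ×-⇔ Sat⁺-⌜⌝ R ψ
Sat⁺-⌜⌝ R (φ ∨ ψ) = Sat⁺-⌜⌝ R φ ⊎-⇔ Sat⁺-⌜⌝ R ψ
-- The embedding renames `φ` along the empty map from `∅` to `∅`, which does not compute to `φ`.
Sat⁺-⌜⌝ R (φ ⇒ ψ) = →-cong-⇔ (Sat-mapₚ ⊥-elim ∅ᴵ ∅ᴵ (λ ()) φ) (Sat⁺-⌜⌝ R ψ)
Sat⁺-⌜⌝ R (all φ) = ∀-⇔ λ a → Sat⁺-⌜⌝ R φ
Sat⁺-⌜⌝ R (ex φ)  = ∃-⇔ λ a → Sat⁺-⌜⌝ R φ

-- Horn formulas

firstOrder?-⌜⌝ : ∀ {N P n} (θ : FO n) → Is-just (firstOrder? {N} {P} ⌜ θ ⌝)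
firstOrder?-⌜⌝ falsum  = just tt
firstOrder?-⌜⌝ verum   = just tt
firstOrder?-⌜⌝ (s ≐ t) = just tt
firstOrder?-⌜⌝ (s ≦ t) = just tt
firstOrder?-⌜⌝ (φ ∧ ψ) = zipWith-just⁺ (firstOrder?-⌜⌝ φ) (firstOrder?-⌜⌝ ψ)
firstOrder?-⌜⌝ (φ ∨ ψ) = zipWith-just⁺ (firstOrder?-⌜⌝ φ) (firstOrder?-⌜⌝ ψ)
firstOrder?-⌜⌝ (φ ⇒ ψ) = zipWith-just⁺ (firstOrder?-⌜⌝ φ) (firstOrder?-⌜⌝ ψ)
firstOrder?-⌜⌝ (all φ) = map-just⁺ (firstOrder?-⌜⌝ φ)
firstOrder?-⌜⌝ (ex φ)  = map-just⁺ (firstOrder?-⌜⌝ φ)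

firstOrder?-sub : ∀ {N P m n} (σ : Fin m → Term n) (φ : Formula N P m) →
                  Is-just (firstOrder? φ) → Is-just (firstOrder? (sub σ φ))
firstOrder?-sub σ falsum  _ = just tt
firstOrder?-sub σ verum   _ = just tt
firstOrder?-sub σ (s ≐ t) _ = just tt
firstOrder?-sub σ (s ≦ t) _ = just tt
firstOrder?-sub σ (φ ∧ ψ) h with p , q ← zipWith-just⁻ h =
  zipWith-just⁺ (firstOrder?-sub σ φ p) (firstOrder?-sub σ ψ q)
firstOrder?-sub σ (φ ∨ ψ) h with p , q ← zipWith-just⁻ h =
  zipWith-just⁺ (firstOrder?-sub σ φ p) (firstOrder?-sub σ ψ q)
firstOrder?-sub σ (φ ⇒ ψ) h with p , q ← zipWith-just⁻ h =
  zipWith-just⁺ (firstOrder?-sub σ φ p) (firstOrder?-sub σ ψ q)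
firstOrder?-sub σ (all φ) h = map-just⁺ (firstOrder?-sub (lift σ) φ (map-just⁻ h))
firstOrder?-sub σ (ex φ)  h = map-just⁺ (firstOrder?-sub (lift σ) φ (map-just⁻ h))

-- The last clause of `conclusion?` is a catch-all that reduces only at a known constructor. The
-- view makes this case split once for all.
data ConclusionView {n k v} : Fm (PVar n k) v → Set where
  atom  : ∀ {i ts} → ConclusionView (pred (I i) ts)
  other : ∀ {φ} → conclusion? φ ≡ Maybe.map inj₂ (firstOrder? φ) → ConclusionView φ

conclusionView : ∀ {n k v} (φ : Fm (PVar n k) v) → ConclusionView φ
conclusionView falsum         = other refl
conclusionView verum          = other refl
conclusionView (s ≐ t)        = other refl
conclusionView (s ≦ t)        = other refl
conclusionView (pred (I i) _) = atom
conclusionView (φ ∧ ψ)        = other refl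
conclusionView (φ ∨ ψ)        = other refl
conclusionView (φ ⇒ ψ)        = other refl
conclusionView (all φ)        = other refl
conclusionView (ex φ)         = other refl

module _ {n k : ℕ} where

  firstOrder⇒conclusion : ∀ {v} (φ : Fm (PVar n k) v) →
                          Is-just (firstOrder? φ) → Is-just (conclusion? φ)
  firstOrder⇒conclusion φ h with conclusionView φ
  ... | atom    = just tt
  ... | other e = subst Is-just (sym e) (map-just⁺ h)

  conclusion?-sub : ∀ {v w} (σ : Fin v → Term w) (φ : Fm (PVar n k) v) →
                    Is-just (conclusion? φ) → Is-just (conclusion? (sub σ φ))
  conclusion?-sub σ φ h with conclusionView φ
  ... | atom    = just tt
  ... | other e = firstOrder⇒conclusion (sub σ φ)
                    (firstOrder?-sub σ φ (map-just⁻ (subst Is-just e h)))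

  -- `premise?` descends through conjunctions and calls `firstOrder?` only at the remaining
  -- connectives, hence an induction of its own.
  premise?-⌜⌝ : ∀ {v} (θ : FO v) → Is-just (premise? {n} {k} ⌜ θ ⌝)
  premise?-⌜⌝ falsum      = just tt
  premise?-⌜⌝ verum       = just tt
  premise?-⌜⌝ (s ≐ t)     = just tt
  premise?-⌜⌝ (s ≦ t)     = just tt
  premise?-⌜⌝ (φ ∧ ψ)     = zipWith-just⁺ (premise?-⌜⌝ φ) (premise?-⌜⌝ ψ)
  premise?-⌜⌝ θ@(_ ∨ _)   = map-just⁺ (firstOrder?-⌜⌝ θ)
  premise?-⌜⌝ θ@(_ ⇒ _)   = map-just⁺ (firstOrder?-⌜⌝ θ)
  premise?-⌜⌝ θ@(all _)   = map-just⁺ (firstOrder?-⌜⌝ θ)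
  premise?-⌜⌝ θ@(ex _)    = map-just⁺ (firstOrder?-⌜⌝ θ)

  -- Success of the parsers at every conjunct, so that `clauses` drops nothing.
  Horn : ∀ {v} → Fm (PVar n k) v → Set
  Horn (π ∧ π′) = Horn π × Horn π′
  Horn (φ ⇒ ψ)  = Is-just (premise? φ) × Is-just (conclusion? ψ)
  Horn _        = ⊥

-- Induction on the program, with assertions generalised to a parseable premise before and a
-- parseable conclusion after. A fresh atom is both, a test only extends the premise, and assignment
-- substitutes into the conclusion.
ṽc-Horn : ∀ {k n} (φ : Fm (PVar n k) k) (p : Program k) (ψ : Fm (PVar n k) k) ν →
          Is-just (premise? φ) → Is-just (conclusion? ψ) → Horn (ṽc φ p ψ ν)
ṽc-Horn φ skip ψ ν hφ hψ = hφ , hψ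
ṽc-Horn φ (j := t) ψ ν hφ hψ = hφ , conclusion?-sub _ ψ hψ
ṽc-Horn φ (p₀ ⨾ p₁) ψ ν hφ hψ =
  ṽc-Horn φ p₀ _ _ hφ (just tt) , ṽc-Horn _ p₁ ψ _ (just tt) hψ
ṽc-Horn φ (if (B , _) then p₀ else p₁) ψ ν hφ hψ =
  ṽc-Horn _ p₀ ψ _ (zipWith-just⁺ hφ (premise?-⌜⌝ B)) hψ ,
  ṽc-Horn _ p₁ ψ _ (zipWith-just⁺ hφ (premise?-⌜⌝ (neg B))) hψ
ṽc-Horn φ (while (B , _) loop p₀) ψ ν hφ hψ =
  ṽc-Horn _ p₀ _ _ (zipWith-just⁺ (just tt) (premise?-⌜⌝ B)) (just tt) ,
  (hφ , just tt) ,
  (zipWith-just⁺ (just tt) (premise?-⌜⌝ (neg B)) , hψ)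

-- Semantics of clauses

firstOrder?-sound : ∀ {S} (R : Interp S) {n} (φ : Fm S n) →
                    MAll.All (λ θ → ∀ ρ → Sat R φ ρ ⇔ Sat ∅ᴵ θ ρ) (firstOrder? φ)
firstOrder?-sound R falsum     = just λ _ → ⇔-id _
firstOrder?-sound R verum      = just λ _ → ⇔-id _
firstOrder?-sound R (s ≐ t)    = just λ _ → ⇔-id _
firstOrder?-sound R (s ≦ t)    = just λ _ → ⇔-id _
firstOrder?-sound R (pred _ _) = nothing
firstOrder?-sound R (φ ∧ ψ)    = zipWith-All⁺ (λ e f ρ → e ρ ×-⇔ f ρ)
  (firstOrder?-sound R φ) (firstOrder?-sound R ψ)
firstOrder?-sound R (φ ∨ ψ)    = zipWith-All⁺ (λ e f ρ → e ρ ⊎-⇔ f ρ)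
  (firstOrder?-sound R φ) (firstOrder?-sound R ψ)
firstOrder?-sound R (φ ⇒ ψ)    = zipWith-All⁺ (λ e f ρ → →-cong-⇔ (e ρ) (f ρ))
  (firstOrder?-sound R φ) (firstOrder?-sound R ψ)
firstOrder?-sound R (all φ)    =
  MAllₚ.gmap (λ e ρ → ∀-⇔ λ a → e (a ∷ ρ)) (firstOrder?-sound R φ)
firstOrder?-sound R (ex φ)     =
  MAllₚ.gmap (λ e ρ → ∃-⇔ λ a → e (a ∷ ρ)) (firstOrder?-sound R φ)

⟦_⟧* : ∀ {m n} → Vec (Term n) m → Vec ℤ n → Vec ℤ m
⟦ ts ⟧* ρ = Vec.map (λ t → ⟦ t ⟧ ρ) ts

module _ {n k v : ℕ} (R : Interp (PVar n k)) where

  Holds : Vec ℤ v → Atom n k v → Set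
  Holds ρ (i , t̄) = R (I i) (⟦ t̄ ⟧* ρ)

  PremiseHolds : Vec ℤ v → FO v × List (Atom n k v) → Set
  PremiseHolds ρ (θ , as) = Sat ∅ᴵ θ ρ × All (Holds ρ) as

  ConclusionHolds : Vec ℤ v → Atom n k v ⊎ FO v → Set
  ConclusionHolds ρ (inj₁ a) = Holds ρ a
  ConclusionHolds ρ (inj₂ θ) = Sat ∅ᴵ θ ρ

  -- Clauses with head ⊥ are disregarded.
  Derives : Vec ℤ v → Clause n k v → Set
  Derives ρ (clause θ as h) = PremiseHolds ρ (θ , as) → MAll.All (Holds ρ) h

  firstOrder-premise?-sound : (φ : Fm (PVar n k) v) →
    MAll.All (λ p → ∀ ρ → Sat R φ ρ ⇔ PremiseHolds ρ p) (Maybe.map (_, []) (firstOrder? φ))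
  firstOrder-premise?-sound φ =
    MAllₚ.gmap (λ e ρ → mk⇔ (_, []) proj₁ ⇔-∘ e ρ) (firstOrder?-sound R φ)

  PremiseHolds-∧ : ∀ {ρ as as′} θ θ′ →
    (PremiseHolds ρ (θ , as) × PremiseHolds ρ (θ′ , as′)) ⇔
    PremiseHolds ρ (θ ∧ θ′ , as List.++ as′)
  PremiseHolds-∧ _ _ = mk⇔
    (λ ((s , h) , (s′ , h′)) → (s , s′) , Allₚ.++⁺ h h′)
    (λ ((s , s′) , h″) → let h , h′ = Allₚ.++⁻ _ h″ in (s , h) , (s′ , h′))

  premise?-sound : (φ : Fm (PVar n k) v) →
    MAll.All (λ p → ∀ ρ → Sat R φ ρ ⇔ PremiseHolds ρ p) (premise? φ)
  premise?-sound (pred (I i) ts) =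
    just λ ρ → mk⇔ (λ r → tt , r ∷ []) (λ { (_ , r ∷ []) → r })
  premise?-sound (φ ∧ ψ) = zipWith-All⁺
    (λ { {θ , _} {θ′ , _} e f ρ → PremiseHolds-∧ θ θ′ ⇔-∘ (e ρ ×-⇔ f ρ) })
    (premise?-sound φ) (premise?-sound ψ)
  premise?-sound falsum    = firstOrder-premise?-sound falsum
  premise?-sound verum     = firstOrder-premise?-sound verum
  premise?-sound φ@(_ ≐ _) = firstOrder-premise?-sound φ
  premise?-sound φ@(_ ≦ _) = firstOrder-premise?-sound φ
  premise?-sound φ@(_ ∨ _) = firstOrder-premise?-sound φ
  premise?-sound φ@(_ ⇒ _) = firstOrder-premise?-sound φ
  premise?-sound φ@(all _) = firstOrder-premise?-sound φ
  premise?-sound φ@(ex _)  = firstOrder-premise?-sound φ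

  conclusion?-sound : (ψ : Fm (PVar n k) v) →
    MAll.All (λ c → ∀ ρ → Sat R ψ ρ ⇔ ConclusionHolds ρ c) (conclusion? ψ)
  conclusion?-sound ψ with conclusionView ψ
  ... | atom    = just λ _ → ⇔-id _
  ... | other e = subst (MAll.All _) (sym e) (MAllₚ.gmap id (firstOrder?-sound R ψ))

  -- A conjunct that fails to parse yields no clause and a goal clause makes `Derives` trivial, so
  -- only implications with an atomic conclusion carry content.
  clauses-derive : (π : Fm (PVar n k) v) {ρ : Vec ℤ v} →
                   Sat R π ρ → All (Derives ρ) (clauses π)
  clauses-derive (π ∧ π′) (s , t) = Allₚ.++⁺ (clauses-derive π s) (clauses-derive π′ t)
  clauses-derive (φ ⇒ ψ) s
    with premise? φ | premise?-sound φ | conclusion? ψ | conclusion?-sound ψ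
  ... | nothing | _      | _             | _      = []
  ... | just _  | just _ | nothing       | _      = []
  ... | just _  | just e | just (inj₁ _) | just f =
    (λ p → just (to (f _) (s (from (e _) p)))) ∷ []
  ... | just _  | just _ | just (inj₂ _) | _      = (λ _ → nothing) ∷ []
  clauses-derive falsum     _ = []
  clauses-derive verum      _ = []
  clauses-derive (_ ≐ _)    _ = []
  clauses-derive (_ ≦ _)    _ = []
  clauses-derive (pred _ _) _ = []
  clauses-derive (_ ∨ _)    _ = []
  clauses-derive (all _)    _ = []
  clauses-derive (ex _)     _ = []

Horn-transfer : ∀ {n k v} (L R : Interp (PVar n k)) → L ⊆ R →
                (π : Fm (PVar n k) v) {ρ : Vec ℤ v} → Horn π →
                Sat R π ρ → All (Derives L ρ) (clauses π) → Sat L π ρ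
Horn-transfer L R L⊆R (π ∧ π′) (h , h′) (s , s′) ds =
  let d , d′ = Allₚ.++⁻ (clauses π) ds
  in Horn-transfer L R L⊆R π h s d , Horn-transfer L R L⊆R π′ h′ s′ d′
Horn-transfer L R L⊆R (φ ⇒ ψ) (hφ , hψ) s ds x
  -- The soundness statements and `ds` all mention the two parses, so everything is abstracted at
  -- once; `hφ` and `hψ` exclude failed parses.
  with premise? φ    | hφ     | premise?-sound L φ    | premise?-sound R φ
     | conclusion? ψ | hψ     | conclusion?-sound L ψ | conclusion?-sound R ψ | ds
... | just _         | just _ | just eL | just eR
    | just (inj₁ _)  | just _ | just fL | just fR | d ∷ [] =
  -- Atomic conclusion: the clause derives it in `L` itself.
  from (fL _) (MAll.drop-just (d (to (eL _) x)))
... | just _         | just _ | just eL | just eR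
    | just (inj₂ _)  | just _ | just fL | just fR | _ =
  -- First-order conclusion: the premise moves to `R` by `L⊆R` on its atoms, `R` satisfies the
  -- implication, and `fR` and `fL` meet in the same parsed formula, interpreted without predicates.
  let θ , as = to (eL _) x
  in from (fL _) (to (fR _) (s (from (eR _) (θ , All.map (L⊆R _) as))))

-- The operator ⟪ Φ π ⟫ applies the definite clauses

Sat⁺-⋀ : ∀ {S} (R : Interp S) {n} (φs : List (Formula ∅ S n)) {ρ} →
         Sat⁺ R (⋀ φs) ρ ⇔ All (λ φ → Sat⁺ R φ ρ) φs
Sat⁺-⋀ R []       = mk⇔ (λ _ → []) (λ _ → tt)
Sat⁺-⋀ R (φ ∷ φs) = mk⇔ (λ (s , t) → s ∷ to (Sat⁺-⋀ R φs) t)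
                        (λ { (s ∷ t) → s , from (Sat⁺-⋀ R φs) t })

module _ {S : Sig} (R : Interp S) {n} {A B : Set}
         (f : B → Formula ∅ S n) (g : A → Maybe B) {ρ : Vec ℤ n} where

  -- Isolates the case split on `g x`, on which `mapMaybe` is stuck.
  Sat⁺-⋁-mapMaybe-∷ : ∀ x xs →
    Sat⁺ R (⋁ (List.map f (mapMaybe g (x ∷ xs)))) ρ ⇔
    (MAny.Any (λ y → Sat⁺ R (f y) ρ) (g x) ⊎ Sat⁺ R (⋁ (List.map f (mapMaybe g xs))) ρ)
  Sat⁺-⋁-mapMaybe-∷ x xs with g x
  ... | nothing = mk⇔ inj₂ λ { (inj₁ ()) ; (inj₂ s) → s }
  ... | just y  = mk⇔ just (λ { (just s) → s }) ⊎-⇔ ⇔-id _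

  -- Turns a disjunction over the extracted clauses into `Any` over the original list, so that the
  -- base and the inductive disjunctions range over the same list.
  Sat⁺-⋁-mapMaybe : ∀ xs → Sat⁺ R (⋁ (List.map f (mapMaybe g xs))) ρ ⇔
                           Any (λ x → MAny.Any (λ y → Sat⁺ R (f y) ρ) (g x)) xs
  Sat⁺-⋁-mapMaybe []       = mk⇔ (λ ()) (λ ())
  Sat⁺-⋁-mapMaybe (x ∷ xs) =
    mk⇔ Any.fromSum Any.toSum
    ⇔-∘ ((⇔-id _ ⊎-⇔ Sat⁺-⋁-mapMaybe xs) ⇔-∘ Sat⁺-⋁-mapMaybe-∷ x xs)

Sat⁺-ex* : ∀ {S} (R : Interp S) v {n} (φ : Formula ∅ S (v + n)) {ρ} →
           Sat⁺ R (ex* v φ) ρ ⇔ (Σ[ ys ∈ Vec ℤ v ] Sat⁺ R φ (ys Vec.++ ρ))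
Sat⁺-ex* R zero    φ = mk⇔ ([] ,_) (λ { ([] , s) → s })
Sat⁺-ex* R (suc v) φ =
  -- The innermost quantifier binds index zero, so its witness becomes the head of the vector.
  mk⇔ (λ (ys , a , s) → a ∷ ys , s) (λ { (a ∷ ys , s) → ys , a , s }) ⇔-∘ Sat⁺-ex* R v (ex φ)

module _ {n k v : ℕ} (R : Interp (PVar n k)) (ȳ : Vec ℤ v) (a : Vec ℤ k) where

  ⟦↑ȳ⟧ : ∀ i → ⟦ var (i ↑ˡ k) ⟧ (ȳ Vec.++ a) ≡ lookup ȳ i
  ⟦↑ȳ⟧ = Vecₚ.lookup-++ˡ ȳ a

  Sat⁺-constraintᶠ : ∀ θ → Sat⁺ R (constraintᶠ {n} θ) (ȳ Vec.++ a) ⇔ Sat ∅ᴵ θ ȳ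
  Sat⁺-constraintᶠ θ = Sat-sub ∅ᴵ ⟦↑ȳ⟧ θ ⇔-∘ Sat⁺-⌜⌝ R (sub (var ∘ (_↑ˡ k)) θ)

  Sat⁺-z̄≐ : ∀ s̄ → Sat⁺ R (z̄≐ {n} s̄) (ȳ Vec.++ a) ⇔ ⟦ s̄ ⟧* ȳ ≡ a
  Sat⁺-z̄≐ s̄ = mk⇔
    -- Vector extensionality: both sides are tabulations of their own lookups.
    (λ h → sym (trans (sym (Vecₚ.tabulate∘lookup a)) (trans
      (Vecₚ.tabulate-cong λ i → trans (to (e i) (h i)) (sym (Vecₚ.lookup-map i _ s̄)))
      (Vecₚ.tabulate∘lookup _))))
    (λ { refl i → from (e i) (Vecₚ.lookup-map i _ s̄) })
    ⇔-∘ (mk⇔ Allₚ.tabulate⁻ Allₚ.tabulate⁺ ⇔-∘ Sat⁺-⋀ R _)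
    where
    e : ∀ i → Sat⁺ R (var (v ↑ʳ i) ≐ ↑ȳ {n} (lookup s̄ i)) (ȳ Vec.++ a) ⇔
              lookup a i ≡ ⟦ lookup s̄ i ⟧ ȳ
    e i = ≡⇒⇔ (cong₂ _≡_ (Vecₚ.lookup-++ʳ ȳ a i) (⟦subₜ⟧ ⟦↑ȳ⟧ (lookup s̄ i)))

  Sat⁺-atomsᶠ : ∀ as → Sat⁺ R (⋀ (List.map atomᶠ as)) (ȳ Vec.++ a) ⇔ All (Holds R ȳ) as
  Sat⁺-atomsᶠ []             = mk⇔ (λ _ → []) (λ _ → tt)
  Sat⁺-atomsᶠ ((i , t̄) ∷ as) =
    mk⇔ (λ (p , q) → p ∷ q) (λ { (p ∷ q) → p , q })
    ⇔-∘ (≡⇒⇔ (cong (R (I i)) (map-⟦subₜ⟧ ⟦↑ȳ⟧ t̄)) ×-⇔ Sat⁺-atomsᶠ as)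

  -- One application of a clause under the valuation `ȳ` with result `a`, uniform in base and
  -- inductive clauses.
  Fires : Fin n → Clause n k v → Set
  Fires j (clause θ as h) =
    PremiseHolds R ȳ (θ , as) × MAny.Any (λ (i , s̄) → i ≡ j × ⟦ s̄ ⟧* ȳ ≡ a) h

  -- `asBase` takes the empty bodies and `asInd` the nonempty ones, both only when the head symbol
  -- is `j`; hence at most one summand is inhabited.
  Fires-⇔ : ∀ j c → Fires j c ⇔
    (MAny.Any (λ b → Sat⁺ R (baseᶠ b) (ȳ Vec.++ a)) (asBase j c) ⊎
     MAny.Any (λ b → Sat⁺ R (indᶠ b) (ȳ Vec.++ a)) (asInd j c))
  -- The body is split even for the head ⊥, because `asBase` and `asInd` inspect it before the head.
  Fires-⇔ j (clause θ []         nothing) = mk⇔ (λ { (_ , ()) }) (λ { (inj₁ ()) ; (inj₂ ()) })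
  Fires-⇔ j (clause θ (_ ∷ _)    nothing) = mk⇔ (λ { (_ , ()) }) (λ { (inj₁ ()) ; (inj₂ ()) })
  Fires-⇔ j (clause θ [] (just (i , s̄))) with i ≟ j
  ... | no i≢j   = mk⇔ (λ { (_ , just (e , _)) → ⊥-elim (i≢j e) }) (λ { (inj₁ ()) ; (inj₂ ()) })
  ... | yes refl = mk⇔
    (λ { ((s , []) , just (_ , e)) →
           inj₁ (just (from (Sat⁺-constraintᶠ θ) s , from (Sat⁺-z̄≐ s̄) e)) })
    (λ { (inj₁ (just (s , e))) →
           (to (Sat⁺-constraintᶠ θ) s , []) , just (refl , to (Sat⁺-z̄≐ s̄) e) })
  Fires-⇔ j (clause θ as@(_ ∷ _) (just (i , s̄))) with i ≟ j
  ... | no i≢j   = mk⇔ (λ { (_ , just (e , _)) → ⊥-elim (i≢j e) }) (λ { (inj₁ ()) ; (inj₂ ()) })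
  ... | yes refl = mk⇔
    (λ { ((s , r) , just (_ , e)) → inj₂ (just
           (from (Sat⁺-constraintᶠ θ) s , from (Sat⁺-atomsᶠ as) r , from (Sat⁺-z̄≐ s̄) e)) })
    (λ { (inj₂ (just (s , r , e))) →
           (to (Sat⁺-constraintᶠ θ) s , to (Sat⁺-atomsᶠ as) r) ,
           just (refl , to (Sat⁺-z̄≐ s̄) e) })

module _ {n k v : ℕ} (R : Interp (PVar n k)) (π : Fm (PVar n k) v) where

  -- Identifies `⟪ Φ π ⟫` as the immediate consequence operator of logic programming. The two
  -- disjunctions merge because `Any` distributes over sums.
  Sat⁺-Φ : ∀ j a → Sat⁺ R (Φ π (I j)) a ⇔ (Σ[ ȳ ∈ Vec ℤ v ] Any (Fires R ȳ a j) (clauses π))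
  Sat⁺-Φ j a =
    (∃-⇔ λ ȳ →
      mk⇔ (Any.map (from (Fires-⇔ R ȳ a j _))) (Any.map (to (Fires-⇔ R ȳ a j _)))
      ⇔-∘ (mk⇔ Anyₚ.Any-⊎⁺ Anyₚ.Any-⊎⁻
      ⇔-∘ (Sat⁺-⋁-mapMaybe R baseᶠ (asBase j) (clauses π) ⊎-⇔
           Sat⁺-⋁-mapMaybe R indᶠ (asInd j) (clauses π))))
    ⇔-∘ Sat⁺-ex* R v _

  derive⇒closed : (∀ ρ → All (Derives R ρ) (clauses π)) → ⟪ Φ π ⟫ R ⊆ R
  derive⇒closed d (I j) {a} s with to (Sat⁺-Φ j a) s
  -- `lookupAny` pairs the clause that fires with its own `Derives` proof; the equations in `h` then
  -- identify its head with the atom sought.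
  ... | ȳ , fs with All.lookupAny (d ȳ) fs
  ...   | f , p , h with Any.lookup fs
  ...     | clause θ as _ with f p | h
  ...       | just r | just (refl , refl) = r

  closed⇒derive : ⟪ Φ π ⟫ R ⊆ R → ∀ ρ → All (Derives R ρ) (clauses π)
  closed⇒derive c ρ = All.tabulate derives
    where
    derives : ∀ {cl} → cl ∈ clauses π → Derives R ρ cl
    derives {clause θ as nothing}        _    _ = nothing
    derives {clause θ as (just (j , s̄))} cl∈π p =
      -- The valuation `ρ` serves as `ȳ`, and `a` is the value of `s̄` under it, so both head
      -- equations are `refl`.
      just (c (I j) (from (Sat⁺-Φ j _) (ρ , lose cl∈π (p , just (refl , refl)))))

-- The least fixed point as a model

Horn-Lfp : ∀ {n k v} (R : Interp (PVar n k)) (π : Fm (PVar n k) v) → Horn π →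
           (λ {m} → R {m}) ⊨ π → (λ {m} → Lfp (Φ π) {m}) ⊨ π
Horn-Lfp R π h s ρ = Horn-transfer (Lfp (Φ π)) R
  -- The model `R` is closed under the operator, hence contains the least fixed point.
  (Lfp-least (Φ π) R (derive⇒closed R π λ ρ → clauses-derive R π (s ρ)))
  -- `fold` is closure of `Lfp` under its own operator, which supplies the definite clauses.
  π h (s ρ) (closed⇒derive (Lfp (Φ π)) π (λ _ → fold) ρ)

corollary14 : (k : ℕ) (τ : Triple k) →
    (ℤ⊨vc τ) ⇔ (LFPᴵ ⊨ (ṽcᵀ τ) [ μ τ ]ₚ)
corollary14 k τ@(⟨ φ ⟩ p ⟨ ψ ⟩) = mk⇔ model⇒lfp lfp⇒model
  where
  π : Fm (PVar (#ᵀ τ) k) k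
  π = ṽcᵀ τ

  horn : Horn π
  horn = ṽc-Horn ⌜ φ ⌝ p ⌜ ψ ⌝ id (premise?-⌜⌝ φ)
           (firstOrder⇒conclusion ⌜ ψ ⌝ (firstOrder?-⌜⌝ ψ))

  -- At an atom both sides unfold to `Lfp (Φ π)`, so the identity suffices there.
  substituted : ∀ {ρ} → Sat LFPᴵ (π [ μ τ ]ₚ) ρ ⇔ Sat (Lfp (Φ π)) π ρ
  substituted = Sat-mapₚ (μ τ) (Lfp (Φ π)) LFPᴵ (λ _ _ → ⇔-id _) π

  model⇒lfp : ℤ⊨vc τ → LFPᴵ ⊨ π [ μ τ ]ₚ
  model⇒lfp (R , s) ρ = from substituted (Horn-Lfp R π horn s ρ)

  lfp⇒model : LFPᴵ ⊨ π [ μ τ ]ₚ → ℤ⊨vc τ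
  -- The least fixed point itself witnesses the second-order existential quantifiers.
  lfp⇒model s = Lfp (Φ π) , λ ρ → to substituted (s ρ)
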